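{- Let $M,N$ be $\tau$-structures such that $M\equiv N$ (i.e. $\sigma^M=\sigma^N$ for every linear $\tau$-sentence $\sigma$) and both are linearly $\aleph_0$-saturated. Then $M\equiv_{CL}N$, i.e. $\sigma^M=\sigma^N$ for every CL sentence $\sigma$ of $\tau$.
   Context: Logic. A modulus is an increasing continuous concave function $\lambda:[0,\infty)\to[0,\infty)$ with $\lambda(0)=0$; a map $f$ between metric spaces is $\lambda$-continuous if $d(f(x),f(y))\le\lambda(d(x,y))$ for all $x,y$. A signature $\tau$ is a set of function, relation and constant symbols; each function symbol $F$ has a modulus $\lambda_F$, each relation symbol $R$ has a modulus $\lambda_R$ and a bound $\mathbf b_R\ge0$; $\tau$ contains a distinguished binary relation symbol $d$ with $\mathbf b_d=1$. A $\tau$-structure is a (not necessarily complete) metric space $(M,d)$ with $d$ interpreted as the metric (so diameter $\le1$), each $F^M:M^n\to M$ being $\lambda_F$-continuous, each $R^M:M^n\to\mathbb R$ being $\lambda_R$-continuous with $|R^M|\le\mathbf b_R$, where $M^n$ carries the metric $\sum_{i=1}^n d(x_i,y_i)$. CL formulas are built inductively from $r$ ($r\in\mathbb R$), $d(t_1,t_2)$, $R(t_1,\dots,t_n)$ ($t_i$ terms) by $r\phi$, $\phi+\psi$, $\phi\wedge\psi$ (minimum), $\phi\vee\psi$ (maximum), $\sup_x\phi$, $\inf_x\phi$, and evaluated in the obvious way; linear formulas are those built without $\wedge,\vee$. A linear condition is $\phi\le\psi$ with $\phi,\psi$ linear formulas. Types. For $A\subseteq M$, let $T_A$ be the set of all closed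 linear conditions with parameters from $A$ true in $M$. An element of $S_n(A)$ (a linear $n$-type over $A$) is a maximal set $p(\bar x)$ of linear conditions $\phi(\bar x)\le\psi(\bar x)$, $|\bar x|=n$, with parameters in $A$ such that $T_A\cup p(\bar x)$ is satisfied by some tuple in some model of $T_A$. It is realized in $M$ if some $\bar a\in M^n$ satisfies all its conditions. $M$ is linearly $\kappa$-saturated if every $p\in S_1(A)$ is realized in $M$ whenever $A\subseteq M$ and $|A|<\kappa$. -}

module Defs where

open import Algebra.Bundles using (CommutativeRing)
import Algebra.Construct.NaturalChoice.Max as Max
import Algebra.Construct.NaturalChoice.Min as Min
import Algebra.Properties.CommutativeMonoid.Sum as Sum
import Algebra.Properties.Ring as RingProperties
open import Data.Fin.Base using (Fin)
open import Data.List.Base using (List)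
import Data.List.Membership.Setoid as Membership
open import Data.Nat.Base using (ℕ; suc)
open import Data.Product.Base using (Σ; ∃; _×_; _,_; proj₁; proj₂)
open import Data.Sum.Base using (_⊎_; inj₁; inj₂; [_,_]′)
open import Data.Vec.Functional using (Vector; []; _∷_)
open import Function.Bundles using (_⇔_)
open import Level using (Level)
open import Relation.Binary.Bundles using (Setoid; TotalOrder)
open import Relation.Binary.Core using (Rel)
open import Relation.Binary.Structures using (IsTotalOrder)
open import Relation.Nullary.Negation.Core using (¬_)
open import Relation.Unary using (Pred; _∈_; _⊆_)

------------------------------------------------------------------------
-- The real numbers

module Bounds {ℓ} {A : Set ℓ} (_≤_ : Rel A ℓ) where

  UpperBound LowerBound : Pred A ℓ → Pred A ℓ
  UpperBound P b = ∀ x → x ∈ P → x ≤ b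
  LowerBound P b = ∀ x → x ∈ P → b ≤ x

  IsSup IsInf : Pred A ℓ → Pred A ℓ
  IsSup P s = s ∈ UpperBound P × (∀ b → b ∈ UpperBound P → s ≤ b)
  IsInf P i = i ∈ LowerBound P × (∀ b → b ∈ LowerBound P → b ≤ i)

-- The real numbers, given by their categorical axiomatisation: a
-- totally ordered field in which every non-empty set that is bounded
-- above has a least upper bound.  The axioms are the classical ones
-- (e.g. the order is total in the strong sense of `_⊎_`).
record CompleteOrderedField (ℓ : Level) : Set (Level.suc ℓ) where
  infix 4 _≤_
  field
    commutativeRing : CommutativeRing ℓ ℓ

  open CommutativeRing commutativeRing public

  field
    _≤_          : Rel Carrier ℓ
    isTotalOrder : IsTotalOrder _≈_ _≤_
    0≉1          : ¬ 0# ≈ 1#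
    inverse      : ∀ x → ¬ x ≈ 0# → ∃ λ y → x * y ≈ 1#
    +-monoˡ-≤    : ∀ z {x y} → x ≤ y → x + z ≤ y + z
    *-nonNeg     : ∀ {x y} → 0# ≤ x → 0# ≤ y → 0# ≤ x * y

  open Bounds _≤_ public

  field
    supremum : ∀ P → ∃ P → ∃ (UpperBound P) → ∃ (IsSup P)

module Real {ℓ} (ℝ : CompleteOrderedField ℓ) where

  open CompleteOrderedField ℝ public

  infimum : ∀ P → ∃ P → ∃ (LowerBound P) → ∃ (IsInf P)
  infimum P (x , x∈P) bounded
    with supremum (LowerBound P) bounded (x , λ b b≤P → b≤P x x∈P)
  ... | i , upper , least =
    i , (λ y y∈P → least y λ b b≤P → b≤P y y∈P) , upper

  totalOrder : TotalOrder ℓ ℓ ℓ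
  totalOrder = record { isTotalOrder = isTotalOrder }

  open IsTotalOrder isTotalOrder public
    using (total; antisym; ≤-respˡ-≈; ≤-respʳ-≈)
    renaming (refl to ≤-refl; trans to ≤-trans; reflexive to ≤-reflexive)
  open Max totalOrder public using (_⊔_; ⊔-mono-≤; x≤x⊔y; x≤y⊔x)
  open Min totalOrder public using (_⊓_; ⊓-mono-≤)
  open Sum +-commutativeMonoid public using (sum)

  infix 4 _<_

  _<_ : Rel Carrier ℓ
  x < y = x ≤ y × ¬ x ≈ y

  ∣_∣ : Carrier → Carrier
  ∣ x ∣ = x ⊔ - x

  private
    open RingProperties ring using (-‿involutive; x[y-z]≈xy-xz; -‿distribˡ-*; -‿distribʳ-*)

    +-monoʳ-≤ : ∀ z {x y} → x ≤ y → z + x ≤ z + y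
    +-monoʳ-≤ z {x} {y} x≤y =
      ≤-respˡ-≈ (+-comm x z) (≤-respʳ-≈ (+-comm y z) (+-monoˡ-≤ z x≤y))

    cancel : ∀ x y → x - y + y ≈ x
    cancel x y = trans (+-assoc x (- y) y) (trans (+-congˡ (-‿inverseˡ y)) (+-identityʳ x))

    x≤y⇒0≤y-x : ∀ {x y} → x ≤ y → 0# ≤ y - x
    x≤y⇒0≤y-x {x} x≤y = ≤-respˡ-≈ (-‿inverseʳ x) (+-monoˡ-≤ (- x) x≤y)

    0≤y-x⇒x≤y : ∀ {x y} → 0# ≤ y - x → x ≤ y
    0≤y-x⇒x≤y {x} {y} p =
      ≤-respˡ-≈ (+-identityˡ x) (≤-respʳ-≈ (cancel y x) (+-monoˡ-≤ x p))

    neg-swap : ∀ x y → y - x ≈ - x - - y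
    neg-swap x y = trans (+-comm y (- x)) (+-congˡ (sym (-‿involutive y)))

  +-mono-≤ : ∀ {x y u v} → x ≤ y → u ≤ v → x + u ≤ y + v
  +-mono-≤ {y = y} {u} x≤y u≤v = ≤-trans (+-monoˡ-≤ u x≤y) (+-monoʳ-≤ y u≤v)

  neg-anti-≤ : ∀ {x y} → x ≤ y → - y ≤ - x
  neg-anti-≤ {x} {y} x≤y = 0≤y-x⇒x≤y (≤-respʳ-≈ (neg-swap x y) (x≤y⇒0≤y-x x≤y))

  *-monoˡ-≤-nonNeg : ∀ {r x y} → 0# ≤ r → x ≤ y → r * x ≤ r * y
  *-monoˡ-≤-nonNeg {r} {x} {y} 0≤r x≤y =
    0≤y-x⇒x≤y (≤-respʳ-≈ (x[y-z]≈xy-xz r y x) (*-nonNeg 0≤r (x≤y⇒0≤y-x x≤y)))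

  *-monoˡ-≤-nonPos : ∀ {r x y} → r ≤ 0# → x ≤ y → r * y ≤ r * x
  *-monoˡ-≤-nonPos {r} {x} {y} r≤0 x≤y =
    ≤-respˡ-≈ (-r*-z≈r*z y) (≤-respʳ-≈ (-r*-z≈r*z x)
      (*-monoˡ-≤-nonNeg 0≤-r (neg-anti-≤ x≤y)))
    where
    0≤-r : 0# ≤ - r
    0≤-r = ≤-respʳ-≈ (+-identityˡ (- r)) (x≤y⇒0≤y-x r≤0)
    -r*-z≈r*z : ∀ z → - r * - z ≈ r * z
    -r*-z≈r*z z = trans (sym (-‿distribˡ-* r (- z)))
      (trans (-‿cong (sym (-‿distribʳ-* r z))) (-‿involutive (r * z)))

  ∣x∣≤b⇒-b≤x : ∀ {x b} → ∣ x ∣ ≤ b → - b ≤ x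
  ∣x∣≤b⇒-b≤x {x} p =
    ≤-respʳ-≈ (-‿involutive x) (neg-anti-≤ (≤-trans (x≤y⊔x x (- x)) p))

  ∣x∣≤b⇒x≤b : ∀ {x b} → ∣ x ∣ ≤ b → x ≤ b
  ∣x∣≤b⇒x≤b {x} p = ≤-trans (x≤x⊔y x (- x)) p

  Bounded : ∀ {i} {I : Set i} → (I → Carrier) → Set _
  Bounded f = ∃ λ lo → ∃ λ hi → ∀ i → lo ≤ f i × f i ≤ hi

  module Range {I : Set ℓ} (f : I → Carrier) where

    Image : Pred Carrier ℓ
    Image r = ∃ λ i → r ≈ f i

    private
      nonEmpty : I → ∃ Image
      nonEmpty i = f i , i , refl

      above : Bounded f → ∃ (UpperBound Image)
      above (_ , hi , b) = hi , λ _ (i , r≈fi) → ≤-respˡ-≈ (sym r≈fi) (proj₂ (b i))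

      below : Bounded f → ∃ (LowerBound Image)
      below (lo , _ , b) = lo , λ _ (i , r≈fi) → ≤-respʳ-≈ (sym r≈fi) (proj₁ (b i))

    sup : I → Bounded f → ∃ (IsSup Image)
    sup i b = supremum Image (nonEmpty i) (above b)

    inf : I → Bounded f → ∃ (IsInf Image)
    inf i b = infimum Image (nonEmpty i) (below b)

    IsSup-bounds : ∀ {lo hi s} → I → (∀ i → lo ≤ f i × f i ≤ hi) →
                   IsSup Image s → lo ≤ s × s ≤ hi
    IsSup-bounds i b (upper , least) =
      ≤-trans (proj₁ (b i)) (upper (f i) (i , refl)) ,
      least _ (λ _ (j , r≈fj) → ≤-respˡ-≈ (sym r≈fj) (proj₂ (b j)))

    IsInf-bounds : ∀ {lo hi s} → I → (∀ i → lo ≤ f i × f i ≤ hi) →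
                   IsInf Image s → lo ≤ s × s ≤ hi
    IsInf-bounds i b (lower , greatest) =
      greatest _ (λ _ (j , r≈fj) → ≤-respʳ-≈ (sym r≈fj) (proj₁ (b j))) ,
      ≤-trans (lower (f i) (i , refl)) (proj₂ (b i))

------------------------------------------------------------------------
-- Moduli and signatures

module _ {ℓ} (ℝ : CompleteOrderedField ℓ) where

  private module ℝ = Real ℝ
  open ℝ using (0#; 1#; _≈_; _≤_; _<_; _+_; _*_; _-_; ∣_∣)

  -- A function [0,∞) → [0,∞) is a function ℝ → ℝ of which only the
  -- restriction to [0,∞) matters.  "Increasing" is read weakly.
  record Modulus : Set ℓ where
    field
      fun        : ℝ.Carrier → ℝ.Carrier
      nonNeg     : ∀ {t} → 0# ≤ t → 0# ≤ fun t
      zero       : fun 0# ≈ 0#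
      increasing : ∀ {s t} → 0# ≤ s → s ≤ t → fun s ≤ fun t
      continuous : ∀ {t} → 0# ≤ t → ∀ ε → 0# < ε → ∃ λ δ → 0# < δ ×
                   (∀ {s} → 0# ≤ s → ∣ s - t ∣ < δ → ∣ fun s - fun t ∣ < ε)
      concave    : ∀ {s t θ} → 0# ≤ s → 0# ≤ t → 0# ≤ θ → θ ≤ 1# →
                   θ * fun s + (1# - θ) * fun t ≤ fun (θ * s + (1# - θ) * t)

  -- `Relation` holds the relation symbols other than d, whose modulus
  -- is `dModulus`; its arity 2 and bound 1 are fixed.
  record Signature : Set (Level.suc ℓ) where
    field
      Function Relation Constant : Set ℓ
      fArity   : Function → ℕ
      fModulus : Function → Modulus
      rArity   : Relation → ℕ
      rModulus : Relation → Modulus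
      rBound   : Relation → ℝ.Carrier
      0≤rBound : ∀ R → 0# ≤ rBound R
      dModulus : Modulus

module _ {ℓ} {ℝ : CompleteOrderedField ℓ} where

  private module ℝ = Real ℝ
  open ℝ using (0#; 1#; _≤_; _+_; _-_; ∣_∣) renaming (Carrier to |ℝ|)

  -- Equality of points is the setoid equality of `points`; function
  -- and relation symbols respect it because they are λ-continuous.
  -- Structures are non-empty, as usual (otherwise sup is undefined).
  record Structure (τ : Signature ℝ) : Set (Level.suc ℓ) where
    open Signature τ
    open Modulus
    field
      points : Setoid ℓ ℓ

    open Setoid points public using (_≈_) renaming (Carrier to Point)

    field
      point    : Point
      d        : Point → Point → |ℝ|
      d-nonNeg : ∀ x y → 0# ≤ d x y
      d≈0⇒≈    : ∀ {x y} → d x y ℝ.≈ 0# → x ≈ y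
      ≈⇒d≈0    : ∀ {x y} → x ≈ y → d x y ℝ.≈ 0#
      d-sym    : ∀ x y → d x y ℝ.≈ d y x
      triangle : ∀ x y z → d x z ≤ d x y + d y z
      d≤1      : ∀ x y → d x y ≤ 1#

    dⁿ : ∀ {n} → Vector Point n → Vector Point n → |ℝ|
    dⁿ x y = ℝ.sum λ i → d (x i) (y i)

    field
      constant     : Constant → Point
      function     : ∀ F → Vector Point (fArity F) → Point
      relation     : ∀ R → Vector Point (rArity R) → |ℝ|
      f-continuous : ∀ F x y → d (function F x) (function F y) ≤ fun (fModulus F) (dⁿ x y)
      r-continuous : ∀ R x y → ∣ relation R x - relation R y ∣ ≤ fun (rModulus R) (dⁿ x y)
      d-continuous : ∀ x y x′ y′ →
                     ∣ d x y - d x′ y′ ∣ ≤ fun dModulus (dⁿ (x ∷ y ∷ []) (x′ ∷ y′ ∷ []))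
      r-bounded    : ∀ R x → ∣ relation R x ∣ ≤ rBound R

------------------------------------------------------------------------
-- Formulas

  module _ (τ : Signature ℝ) where
    open Signature τ

    -- The index is the number of variables in scope (de Bruijn indices).
    data Term (n : ℕ) : Set ℓ where
      var : Fin n → Term n
      con : Constant → Term n
      fun : ∀ F → Vector (Term n) (fArity F) → Term n

    infixr 8 _·_
    infixl 7 _∧_
    infixl 6 _⊕_ _∨_

    data Formula (n : ℕ) : Set ℓ where
      real        : |ℝ| → Formula n
      dist        : Term n → Term n → Formula n
      rel         : ∀ R → Vector (Term n) (rArity R) → Formula n
      _·_         : |ℝ| → Formula n → Formula n
      _⊕_ _∧_ _∨_ : Formula n → Formula n → Formula n
      Sup Inf     : Formula (suc n) → Formula n

    Sentence : Set ℓ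
    Sentence = Formula 0

  module _ {τ : Signature ℝ} where

    data Linear {n : ℕ} : Formula τ n → Set ℓ where
      real : ∀ r → Linear (real r)
      dist : ∀ s t → Linear (dist s t)
      rel  : ∀ R ts → Linear (rel R ts)
      _·_  : ∀ r {φ} → Linear φ → Linear (r · φ)
      _⊕_  : ∀ {φ ψ} → Linear φ → Linear ψ → Linear (φ ⊕ ψ)
      Sup  : ∀ {φ} → Linear φ → Linear (Sup φ)
      Inf  : ∀ {φ} → Linear φ → Linear (Inf φ)

    module Semantics (M : Structure τ) where
      open Structure M

      evalTerm : ∀ {n} → Term τ n → Vector Point n → Point
      evalTerm (var i)    v = v i
      evalTerm (con c)    v = constant c
      evalTerm (fun F ts) v = function F (λ i → evalTerm (ts i) v)

      -- Defined together with a bound, which the suprema and infima need.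
      eval    : ∀ {n} → Formula τ n → Vector Point n → |ℝ|
      bounded : ∀ {n} (φ : Formula τ n) → ℝ.Bounded (eval φ)

      bounded-at : ∀ {n} (φ : Formula τ (suc n)) (v : Vector Point n) →
                   ℝ.Bounded (λ x → eval φ (x ∷ v))

      eval (real r)   v = r
      eval (dist s t) v = d (evalTerm s v) (evalTerm t v)
      eval (rel R ts) v = relation R (λ i → evalTerm (ts i) v)
      eval (r · φ)    v = r ℝ.* eval φ v
      eval (φ ⊕ ψ)    v = eval φ v + eval ψ v
      eval (φ ∧ ψ)    v = eval φ v ℝ.⊓ eval ψ v
      eval (φ ∨ ψ)    v = eval φ v ℝ.⊔ eval ψ v
      eval (Sup φ)    v = proj₁ (ℝ.Range.sup (λ x → eval φ (x ∷ v)) point (bounded-at φ v))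
      eval (Inf φ)    v = proj₁ (ℝ.Range.inf (λ x → eval φ (x ∷ v)) point (bounded-at φ v))

      bounded-at φ v = let lo , hi , b = bounded φ in lo , hi , λ x → b (x ∷ v)

      bounded (real r)   = r , r , λ _ → ℝ.≤-refl , ℝ.≤-refl
      bounded (dist s t) = 0# , 1# , λ _ → d-nonNeg _ _ , d≤1 _ _
      bounded (rel R ts) = ℝ.- rBound R , rBound R , λ _ →
        ℝ.∣x∣≤b⇒-b≤x (r-bounded R _) , ℝ.∣x∣≤b⇒x≤b (r-bounded R _)
        where open Signature τ
      bounded (r · φ) with bounded φ | ℝ.total 0# r
      ... | lo , hi , b | inj₁ 0≤r = r ℝ.* lo , r ℝ.* hi , λ v →
        ℝ.*-monoˡ-≤-nonNeg 0≤r (proj₁ (b v)) , ℝ.*-monoˡ-≤-nonNeg 0≤r (proj₂ (b v))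
      ... | lo , hi , b | inj₂ r≤0 = r ℝ.* hi , r ℝ.* lo , λ v →
        ℝ.*-monoˡ-≤-nonPos r≤0 (proj₂ (b v)) , ℝ.*-monoˡ-≤-nonPos r≤0 (proj₁ (b v))
      bounded (φ ⊕ ψ) with bounded φ | bounded ψ
      ... | lo , hi , b | lo′ , hi′ , b′ = lo + lo′ , hi + hi′ , λ v →
        ℝ.+-mono-≤ (proj₁ (b v)) (proj₁ (b′ v)) , ℝ.+-mono-≤ (proj₂ (b v)) (proj₂ (b′ v))
      bounded (φ ∧ ψ) with bounded φ | bounded ψ
      ... | lo , hi , b | lo′ , hi′ , b′ = lo ℝ.⊓ lo′ , hi ℝ.⊓ hi′ , λ v →
        ℝ.⊓-mono-≤ (proj₁ (b v)) (proj₁ (b′ v)) , ℝ.⊓-mono-≤ (proj₂ (b v)) (proj₂ (b′ v))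
      bounded (φ ∨ ψ) with bounded φ | bounded ψ
      ... | lo , hi , b | lo′ , hi′ , b′ = lo ℝ.⊔ lo′ , hi ℝ.⊔ hi′ , λ v →
        ℝ.⊔-mono-≤ (proj₁ (b v)) (proj₁ (b′ v)) , ℝ.⊔-mono-≤ (proj₂ (b v)) (proj₂ (b′ v))
      bounded (Sup φ) = let lo , hi , b = bounded φ in lo , hi , λ v →
        ℝ.Range.IsSup-bounds _ point (λ x → b (x ∷ v))
          (proj₂ (ℝ.Range.sup _ point (bounded-at φ v)))
      bounded (Inf φ) = let lo , hi , b = bounded φ in lo , hi , λ v →
        ℝ.Range.IsInf-bounds _ point (λ x → b (x ∷ v))
          (proj₂ (ℝ.Range.inf _ point (bounded-at φ v)))

    infix 4 _≡ₗ_ _≡CL_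

    _≡ₗ_ _≡CL_ : Structure τ → Structure τ → Set ℓ
    M ≡ₗ N = ∀ (σ : Sentence τ) → Linear σ →
             Semantics.eval M σ [] ℝ.≈ Semantics.eval N σ []
    M ≡CL N = ∀ (σ : Sentence τ) →
              Semantics.eval M σ [] ℝ.≈ Semantics.eval N σ []

------------------------------------------------------------------------
-- Linear conditions and types

  module _ (τ : Signature ℝ) where

    -- The condition lhs ≤ rhs.
    record Condition (n : ℕ) : Set ℓ where
      constructor condition
      field
        lhs rhs    : Formula τ n
        lhs-linear : Linear lhs
        rhs-linear : Linear rhs

    -- τ with a new constant symbol for every element of C.
    _⟨_⟩ : Set ℓ → Signature ℝ
    _⟨_⟩ C = record τ { Constant = Signature.Constant τ ⊎ C }

  Holds : ∀ {τ} (M : Structure τ) {n} → Vector (Structure.Point M) n → Pred (Condition τ n) ℓ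
  Holds M a c = eval lhs a ≤ eval rhs a
    where
    open Semantics M
    open Condition c

  module _ {τ : Signature ℝ} (M : Structure τ) where
    open Structure M

    module _ (A : Pred Point ℓ) where

      τ⟨A⟩ : Signature ℝ
      τ⟨A⟩ = τ ⟨ Σ Point A ⟩

      M⟨A⟩ : Structure τ⟨A⟩
      M⟨A⟩ = record
        { Structure M hiding (constant)
        ; constant = [ Structure.constant M , proj₁ ]′
        }

      T : Pred (Condition τ⟨A⟩ 0) ℓ
      T = Holds M⟨A⟩ []

      Satisfiable : ∀ {n} → Pred (Condition τ⟨A⟩ n) ℓ → Set (Level.suc ℓ)
      Satisfiable {n} p = Σ (Structure τ⟨A⟩) λ K → T ⊆ Holds K [] ×
                          ∃ λ (a : Vector (Structure.Point K) n) → p ⊆ Holds K a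

      -- The elements of Sₙ(A).
      S : ∀ n → Pred (Pred (Condition τ⟨A⟩ n) ℓ) (Level.suc ℓ)
      S n p = Satisfiable p × (∀ q → Satisfiable q → p ⊆ q → q ⊆ p)

      Realized : ∀ {n} → Pred (Condition τ⟨A⟩ n) ℓ → Set ℓ
      Realized {n} p = ∃ λ (a : Vector Point n) → p ⊆ Holds M⟨A⟩ a

    Finite : Pred Point ℓ → Set ℓ
    Finite A = ∃ λ (xs : List Point) → ∀ x → A x ⇔ x ∈′ xs
      where open Membership points using () renaming (_∈_ to _∈′_)

    -- |A| < ℵ₀ means that A is finite.
    Linearly-ℵ₀-saturated : Set (Level.suc ℓ)
    Linearly-ℵ₀-saturated = ∀ A → Finite A → ∀ p → p ∈ S A 1 → Realized A p

{-# OPTIONS --safe #-}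

-- A back-and-forth argument.  Call tuples a in M and b in N equivalent if
-- they have the same linear type.  If a and b are equivalent and c is in M,
-- then the linear type of c over a becomes a linear type over b when each
-- parameter aᵢ is replaced by bᵢ: the structure M, with the names of the bᵢ
-- interpreted by the aᵢ, is a model of the linear theory of (N , b).  It is
-- maximal because it determines the value of every linear formula, so
-- saturation gives e in N such that ca and eb are equivalent.  It follows
-- by induction on formulas that equivalent tuples have the same CL type.

module Submission where

open import Defs

import Algebra.Construct.NaturalChoice.Max as Max
import Algebra.Construct.NaturalChoice.Min as Min
import Algebra.Properties.Group as GroupProperties
open import Data.Fin.Base using (Fin; zero; suc)
open import Data.List.Base using (tabulate)
import Data.List.Relation.Unary.Any.Properties as Any
open import Data.Nat.Base using (zero; suc)
open import Data.Product.Base using (∃; _,_; proj₁; proj₂)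
open import Data.Sum.Base using (_⊎_; inj₁; inj₂; [_,_]′; map₁)
open import Data.Vec.Functional using (Vector; []; _∷_)
open import Function.Base using (_∘_)
open import Function.Bundles using (mk⇔)
open import Relation.Binary.Bundles using (Setoid)
open import Relation.Unary using (Pred; _⊆_)

-- Real numbers: vanishing moduli, and suprema and infima of families.

module _ {ℓ} (ℝ : CompleteOrderedField ℓ) where

  open Real ℝ hiding (zero)

  ∣x-y∣≤0⇒x≈y : ∀ {x y} → ∣ x - y ∣ ≤ 0# → x ≈ y
  ∣x-y∣≤0⇒x≈y p = x∙y⁻¹≈ε⇒x≈y _ _
    (antisym (∣x∣≤b⇒x≤b p) (≤-respˡ-≈ ε⁻¹≈ε (∣x∣≤b⇒-b≤x p)))
    where open GroupProperties +-group using (x∙y⁻¹≈ε⇒x≈y; ε⁻¹≈ε)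

  sum≈0 : ∀ {n} {f : Vector Carrier n} → (∀ i → f i ≈ 0#) → sum f ≈ 0#
  sum≈0 {zero}  f≈0 = refl
  sum≈0 {suc n} f≈0 = trans (+-cong (f≈0 zero) (sum≈0 (f≈0 ∘ suc))) (+-identityˡ 0#)

  modulus≤0 : ∀ (μ : Modulus ℝ) {t} → t ≈ 0# → Modulus.fun μ t ≤ 0#
  modulus≤0 μ t≈0 = ≤-respʳ-≈ (Modulus.zero μ)
    (Modulus.increasing μ (≤-reflexive (sym t≈0)) (≤-reflexive t≈0))

  module _ {I J : Set ℓ} {f : I → Carrier} {g : J → Carrier} where

    IsSup-≤ : ∀ {s t} → (∀ i → ∃ λ j → f i ≈ g j) →
              IsSup (Range.Image f) s → IsSup (Range.Image g) t → s ≤ t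
    IsSup-≤ f⊆g (_ , least) (upper , _) =
      least _ λ r (i , r≈fi) → let j , fi≈gj = f⊆g i in upper r (j , trans r≈fi fi≈gj)

    IsInf-≥ : ∀ {s t} → (∀ i → ∃ λ j → f i ≈ g j) →
              IsInf (Range.Image f) s → IsInf (Range.Image g) t → t ≤ s
    IsInf-≥ f⊆g (_ , greatest) (lower , _) =
      greatest _ λ r (i , r≈fi) → let j , fi≈gj = f⊆g i in lower r (j , trans r≈fi fi≈gj)

  module _ {I J : Set ℓ} {f : I → Carrier} {g : J → Carrier}
           (f⊆g : ∀ i → ∃ λ j → f i ≈ g j) (g⊆f : ∀ j → ∃ λ i → f i ≈ g j) where

    private
      g⊆f′ : ∀ j → ∃ λ i → g j ≈ f i
      g⊆f′ j = let i , fi≈gj = g⊆f j in i , sym fi≈gj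

    -- Only the two sets of values have to agree; the index sets may differ. For `M` and `N`, the
    -- forth and back moves supply the two inclusions.
    IsSup-cong : ∀ {s t} → IsSup (Range.Image f) s → IsSup (Range.Image g) t → s ≈ t
    IsSup-cong p q = antisym (IsSup-≤ f⊆g p q) (IsSup-≤ g⊆f′ q p)

    IsInf-cong : ∀ {s t} → IsInf (Range.Image f) s → IsInf (Range.Image g) t → s ≈ t
    IsInf-cong p q = antisym (IsInf-≥ g⊆f′ q p) (IsInf-≥ f⊆g p q)

module _ {ℓ} {ℝ : CompleteOrderedField ℓ} where

  private module ℝ = Real ℝ
  open Max ℝ.totalOrder using (⊔-cong)
  open Min ℝ.totalOrder using (⊓-cong)

  -- Symbols respect equality of points.

  module _ {τ : Signature ℝ} (M : Structure τ) where

    open Structure M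
    open Signature τ

    dⁿ≈0 : ∀ {n} {x y : Vector Point n} → (∀ i → x i ≈ y i) → dⁿ x y ℝ.≈ ℝ.0#
    dⁿ≈0 x≈y = sum≈0 ℝ (≈⇒d≈0 ∘ x≈y)

    -- A modulus vanishes at 0, so continuity bounds the distance between the two values by 0.
    function-cong : ∀ F {x y} → (∀ i → x i ≈ y i) → function F x ≈ function F y
    function-cong F {x} {y} x≈y = d≈0⇒≈ (ℝ.antisym
      (ℝ.≤-trans (f-continuous F x y) (modulus≤0 ℝ (fModulus F) (dⁿ≈0 x≈y)))
      (d-nonNeg _ _))

    relation-cong : ∀ R {x y} → (∀ i → x i ≈ y i) → relation R x ℝ.≈ relation R y
    relation-cong R {x} {y} x≈y = ∣x-y∣≤0⇒x≈y ℝ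
      (ℝ.≤-trans (r-continuous R x y) (modulus≤0 ℝ (rModulus R) (dⁿ≈0 x≈y)))

    d-cong : ∀ {x y x′ y′} → x ≈ x′ → y ≈ y′ → d x y ℝ.≈ d x′ y′
    d-cong {x} {y} {x′} {y′} x≈x′ y≈y′ = ∣x-y∣≤0⇒x≈y ℝ
      (ℝ.≤-trans (d-continuous _ _ _ _) (modulus≤0 ℝ dModulus
        (dⁿ≈0 {2} {x ∷ y ∷ []} {x′ ∷ y′ ∷ []} λ { zero → x≈x′ ; (suc zero) → y≈y′ })))

  -- Substitution of variables and constants for one another.

  -- Every signature is of this form: τ is τ with constants Constant τ.
  _withConstants_ : Signature ℝ → Set ℓ → Signature ℝ
  τ withConstants C = record τ { Constant = C }

  module _ {τ : Signature ℝ} where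

    -- Variables and constants form one type of leaves, so that a single map can turn parameters
    -- into variables or variables into parameters.
    lift : ∀ {C D : Set ℓ} {m n} → (Fin m ⊎ C → Fin n ⊎ D) → Fin (suc m) ⊎ C → Fin (suc n) ⊎ D
    lift θ (inj₁ zero)    = inj₁ zero
    lift θ (inj₁ (suc i)) = map₁ suc (θ (inj₁ i))
    lift θ (inj₂ c)       = map₁ suc (θ (inj₂ c))

    module _ {C D : Set ℓ} where

      translateTerm : ∀ {m n} → (Fin m ⊎ C → Fin n ⊎ D) →
                      Term (τ withConstants C) m → Term (τ withConstants D) n
      translateTerm θ (var i)    = [ var , con ]′ (θ (inj₁ i))
      translateTerm θ (con c)    = [ var , con ]′ (θ (inj₂ c))
      translateTerm θ (fun F ts) = fun F (λ i → translateTerm θ (ts i))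

      translate : ∀ {m n} → (Fin m ⊎ C → Fin n ⊎ D) →
                  Formula (τ withConstants C) m → Formula (τ withConstants D) n
      translate θ (real r)   = real r
      translate θ (dist s t) = dist (translateTerm θ s) (translateTerm θ t)
      translate θ (rel R ts) = rel R (λ i → translateTerm θ (ts i))
      translate θ (r · φ)    = r · translate θ φ
      translate θ (φ ⊕ ψ)    = translate θ φ ⊕ translate θ ψ
      translate θ (φ ∧ ψ)    = translate θ φ ∧ translate θ ψ
      translate θ (φ ∨ ψ)    = translate θ φ ∨ translate θ ψ
      translate θ (Sup φ)    = Sup (translate (lift θ) φ)
      translate θ (Inf φ)    = Inf (translate (lift θ) φ)

      translate-linear : ∀ {m n} (θ : Fin m ⊎ C → Fin n ⊎ D) {φ} →
                         Linear φ → Linear (translate θ φ)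
      translate-linear θ (real r)   = real r
      translate-linear θ (dist s t) = dist _ _
      translate-linear θ (rel R ts) = rel R _
      translate-linear θ (r · l)    = r · translate-linear θ l
      translate-linear θ (l ⊕ l′)   = translate-linear θ l ⊕ translate-linear θ l′
      translate-linear θ (Sup l)    = Sup (translate-linear (lift θ) l)
      translate-linear θ (Inf l)    = Inf (translate-linear (lift θ) l)

    -- Both `M` itself and `M⟨A⟩ M A` are definitionally of this form, with the points, the metric
    -- and the other symbols of `M`.
    _interpreting_ : ∀ (M : Structure τ) {C : Set ℓ} → (C → Structure.Point M) →
                     Structure (τ withConstants C)
    M interpreting ι = record { Structure M hiding (constant) ; constant = ι }

    module _ (M : Structure τ) {C D : Set ℓ}
             (ι : C → Structure.Point M) (κ : D → Structure.Point M) where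

      open Structure M
      private
        module ≈ = Setoid points
        module C = Semantics (M interpreting ι)
        module D = Semantics (M interpreting κ)

      Compatible : ∀ {m n} → (Fin m ⊎ C → Fin n ⊎ D) → Vector Point m → Vector Point n → Set ℓ
      Compatible θ v w = ∀ s → [ w , κ ]′ (θ s) ≈ [ v , ι ]′ s

      lift-compatible : ∀ {m n} (θ : Fin m ⊎ C → Fin n ⊎ D) {v w} → Compatible θ v w →
                        ∀ x → Compatible (lift θ) (x ∷ v) (x ∷ w)
      lift-compatible θ h x (inj₁ zero) = ≈.refl
      lift-compatible θ h x (inj₁ (suc i)) with θ (inj₁ i) | h (inj₁ i)
      ... | inj₁ _ | p = p
      ... | inj₂ _ | p = p
      lift-compatible θ h x (inj₂ c) with θ (inj₂ c) | h (inj₂ c)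
      ... | inj₁ _ | p = p
      ... | inj₂ _ | p = p

      translateTerm-eval : ∀ {m n} (θ : Fin m ⊎ C → Fin n ⊎ D) {v w} → Compatible θ v w →
                           ∀ t → D.evalTerm (translateTerm θ t) w ≈ C.evalTerm t v
      translateTerm-eval θ h (var i) with θ (inj₁ i) | h (inj₁ i)
      ... | inj₁ _ | p = p
      ... | inj₂ _ | p = p
      translateTerm-eval θ h (con c) with θ (inj₂ c) | h (inj₂ c)
      ... | inj₁ _ | p = p
      ... | inj₂ _ | p = p
      translateTerm-eval θ h (fun F ts) =
        function-cong M F (λ i → translateTerm-eval θ h (ts i))

      -- The substitution lemma. The two sides differ only at the leaves, where `Compatible` gives
      -- agreement; the symbols preserve it, and quantifiers range over the same points on both
      -- sides.
      translate-eval : ∀ {m n} (θ : Fin m ⊎ C → Fin n ⊎ D) {v w} → Compatible θ v w →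
                       ∀ φ → D.eval (translate θ φ) w ℝ.≈ C.eval φ v
      translate-eval θ h (real r)   = ℝ.refl
      translate-eval θ h (dist s t) =
        d-cong M (translateTerm-eval θ h s) (translateTerm-eval θ h t)
      translate-eval θ h (rel R ts) =
        relation-cong M R (λ i → translateTerm-eval θ h (ts i))
      translate-eval θ h (r · φ)    = ℝ.*-congˡ (translate-eval θ h φ)
      translate-eval θ h (φ ⊕ ψ)    = ℝ.+-cong (translate-eval θ h φ) (translate-eval θ h ψ)
      translate-eval θ h (φ ∧ ψ)    = ⊓-cong (translate-eval θ h φ) (translate-eval θ h ψ)
      translate-eval θ h (φ ∨ ψ)    = ⊔-cong (translate-eval θ h φ) (translate-eval θ h ψ)
      translate-eval θ {v} {w} h (Sup φ) = IsSup-cong ℝ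
        (λ x → x , translate-eval (lift θ) (lift-compatible θ h x) φ)
        (λ x → x , translate-eval (lift θ) (lift-compatible θ h x) φ)
        (proj₂ (ℝ.Range.sup _ point (D.bounded-at (translate (lift θ) φ) w)))
        (proj₂ (ℝ.Range.sup _ point (C.bounded-at φ v)))
      translate-eval θ {v} {w} h (Inf φ) = IsInf-cong ℝ
        (λ x → x , translate-eval (lift θ) (lift-compatible θ h x) φ)
        (λ x → x , translate-eval (lift θ) (lift-compatible θ h x) φ)
        (proj₂ (ℝ.Range.inf _ point (D.bounded-at (translate (lift θ) φ) w)))
        (proj₂ (ℝ.Range.inf _ point (C.bounded-at φ v)))

  -- Linear types of tuples.

  module _ {τ : Signature ℝ} (M N : Structure τ) where

    private
      module M where
        open Structure M public
        open Semantics M public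
      module N where
        open Structure N public
        open Semantics N public

    SameLinearType : ∀ {n} → Vector M.Point n → Vector N.Point n → Set ℓ
    SameLinearType {n} a b = ∀ (φ : Formula τ n) → Linear φ → M.eval φ a ℝ.≈ N.eval φ b

  SameLinearType-sym : ∀ {τ} (M N : Structure τ) {n} {a : Vector (Structure.Point M) n} {b} →
                       SameLinearType M N a b → SameLinearType N M b a
  SameLinearType-sym M N a∼b φ l = ℝ.sym (a∼b φ l)

  module _ {τ : Signature ℝ} (N : Structure τ) (A : Pred (Structure.Point N) ℓ)
           (K : Structure (τ⟨A⟩ N A)) where

    conditionsAt : ∀ {n} → Vector (Structure.Point K) n → Pred (Condition (τ⟨A⟩ N A) n) ℓ
    conditionsAt c = Holds K c

    -- `K` itself witnesses satisfiability. A tuple satisfying a larger set gives every linear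
    -- formula its value at `c`, so each condition in that set already holds at `c`.
    conditionsAt∈S : T N A ⊆ Holds K [] → ∀ {n} (c : Vector (Structure.Point K) n) →
                     S N A n (conditionsAt c)
    conditionsAt∈S K⊨T c = (K , (λ {σ} → K⊨T {σ}) , c , λ p → p) , maximal
      where
      module K = Semantics K

      -- p contains φ ≤ r and r ≤ φ, where r is the value of φ at c.
      value : ∀ {p} ((L , _ , b , _) : Satisfiable N A p) → conditionsAt c ⊆ p →
              ∀ φ → Linear φ → Semantics.eval L φ b ℝ.≈ K.eval φ c
      value (L , _ , b , p⊆) c⊆p φ l = ℝ.antisym
        (p⊆ (c⊆p {condition φ (real (K.eval φ c)) l (real _)} ℝ.≤-refl))
        (p⊆ (c⊆p {condition (real (K.eval φ c)) φ (real _) l} ℝ.≤-refl))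

      maximal : ∀ p → Satisfiable N A p → conditionsAt c ⊆ p → p ⊆ conditionsAt c
      maximal p sat@(_ , _ , _ , p⊆) c⊆p {condition φ ψ l m} φ≤ψ∈p =
        ℝ.≤-respˡ-≈ (value sat c⊆p φ l) (ℝ.≤-respʳ-≈ (value sat c⊆p ψ m) (p⊆ φ≤ψ∈p))

  -- Extending a pair of tuples by one point.

  module _ {τ : Signature ℝ} (M N : Structure τ) where

    private
      module M where
        open Structure M public
        open Semantics M public
      module N where
        open Structure N public
        open Semantics N public
        module ≈ = Setoid points

    module _ {n} {a : Vector M.Point n} {b : Vector N.Point n}
             (a∼b : SameLinearType M N a b) where

      -- The index is part of the parameter: a point that occurs several times in `b` has distinct
      -- names for its occurrences, and `position` reads the index off.
      Entry : Pred N.Point ℓ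
      Entry y = ∃ λ i → y N.≈ b i

      Entry-finite : Finite N Entry
      Entry-finite = tabulate b , λ y → mk⇔
        (λ (i , y≈bᵢ) → Any.tabulate⁺ i y≈bᵢ)
        Any.tabulate⁻

      position : ∃ Entry → Fin n
      position (_ , i , _) = i

      M⟨b↦a⟩ : Structure (τ⟨A⟩ N Entry)
      M⟨b↦a⟩ = M interpreting [ M.constant , a ∘ position ]′

      generalize : Fin 0 ⊎ (Signature.Constant τ ⊎ ∃ Entry) → Fin n ⊎ Signature.Constant τ
      generalize (inj₂ (inj₁ c)) = inj₂ c
      generalize (inj₂ (inj₂ y)) = inj₁ (position y)

      -- Replacing each parameter by the variable at its position leaves a linear formula of `τ`, to
      -- which `a∼b` applies.
      sentence-transfer : ∀ (φ : Sentence (τ⟨A⟩ N Entry)) → Linear φ →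
                          Semantics.eval M⟨b↦a⟩ φ [] ℝ.≈ Semantics.eval (M⟨A⟩ N Entry) φ []
      sentence-transfer φ l = ℝ.trans
        (ℝ.sym (translate-eval M [ M.constant , a ∘ position ]′ M.constant generalize
          (λ { (inj₂ (inj₁ c)) → Setoid.refl M.points
             ; (inj₂ (inj₂ y)) → Setoid.refl M.points }) φ))
        (ℝ.trans (a∼b (translate generalize φ) (translate-linear generalize l))
          (translate-eval N [ N.constant , proj₁ ]′ N.constant generalize
            (λ { (inj₂ (inj₁ c)) → N.≈.refl
               -- In `N` the name denotes `y`, while the variable takes the value `b i`.
               ; (inj₂ (inj₂ (_ , _ , y≈bᵢ))) → N.≈.sym y≈bᵢ }) φ))

      M⟨b↦a⟩⊨T : T N Entry ⊆ Holds M⟨b↦a⟩ []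
      M⟨b↦a⟩⊨T {condition φ ψ l m} φ≤ψ =
        ℝ.≤-respˡ-≈ (ℝ.sym (sentence-transfer φ l))
          (ℝ.≤-respʳ-≈ (ℝ.sym (sentence-transfer ψ m)) φ≤ψ)

      -- Saturation concerns 1-types, so only variable 0 stays free; the others become names, which
      -- denote entries of `a` in `M⟨b↦a⟩` and of `b` in `N`.
      instantiate : Fin (suc n) ⊎ Signature.Constant τ →
                    Fin 1 ⊎ (Signature.Constant τ ⊎ ∃ Entry)
      instantiate (inj₁ zero)    = inj₁ zero
      instantiate (inj₁ (suc i)) = inj₂ (inj₂ (b i , i , N.≈.refl))
      instantiate (inj₂ c)       = inj₂ (inj₁ c)

      forth : Linearly-ℵ₀-saturated N → ∀ c → ∃ λ e → SameLinearType M N (c ∷ a) (e ∷ b)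
      forth saturated c with saturated Entry Entry-finite
        (conditionsAt N Entry M⟨b↦a⟩ (λ (_ : Fin 1) → c))
        (conditionsAt∈S N Entry M⟨b↦a⟩ (λ {σ} → M⟨b↦a⟩⊨T {σ}) (λ _ → c))
      ... | e , holds = e zero , λ φ l →
        let
          φ′ = translate instantiate φ
          l′ = translate-linear instantiate l
          r  = Semantics.eval M⟨b↦a⟩ φ′ (λ _ → c)
        in
        ℝ.trans
          (ℝ.sym (translate-eval M M.constant [ M.constant , a ∘ position ]′ instantiate
            (λ { (inj₁ zero)    → Setoid.refl M.points
               ; (inj₁ (suc i)) → Setoid.refl M.points
               ; (inj₂ _)       → Setoid.refl M.points }) φ))
          (ℝ.trans
            -- As `r` is the value of `φ′` at `c`, both conditions belong to the type of `c`, and so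
            -- they hold at `e`.
            (ℝ.antisym
              (holds {condition (real r) φ′ (real r) l′} ℝ.≤-refl)
              (holds {condition φ′ (real r) l′ (real r)} ℝ.≤-refl))
            (translate-eval N N.constant [ N.constant , proj₁ ]′ instantiate
              (λ { (inj₁ zero)    → N.≈.refl
                 ; (inj₁ (suc i)) → N.≈.refl
                 ; (inj₂ _)       → N.≈.refl }) φ))

  -- Back and forth, and CL formulas.

  module _ {τ : Signature ℝ} (M N : Structure τ)
           (M-saturated : Linearly-ℵ₀-saturated M) (N-saturated : Linearly-ℵ₀-saturated N) where

    private
      module M where
        open Structure M public
        open Semantics M public
      module N where
        open Structure N public
        open Semantics N public

    back : ∀ {n} {a : Vector M.Point n} {b : Vector N.Point n} → SameLinearType M N a b →
           ∀ e → ∃ λ c → SameLinearType M N (c ∷ a) (e ∷ b)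
    back a∼b e =
      let c , eb∼ca = forth N M (SameLinearType-sym M N a∼b) M-saturated e
      in  c , SameLinearType-sym N M eb∼ca

    -- By induction on `φ`. The hypothesis on the tuples concerns all linear formulas, not only `φ`,
    -- so it survives adding a point under a quantifier even when `φ` contains `∧` or `∨`.
    SameLinearType⇒SameCLType : ∀ {n} (φ : Formula τ n) {a b} → SameLinearType M N a b →
                                M.eval φ a ℝ.≈ N.eval φ b
    SameLinearType⇒SameCLType (real r)   a∼b = ℝ.refl
    SameLinearType⇒SameCLType (dist s t) a∼b = a∼b _ (dist s t)
    SameLinearType⇒SameCLType (rel R ts) a∼b = a∼b _ (rel R ts)
    SameLinearType⇒SameCLType (r · φ)    a∼b = ℝ.*-congˡ (SameLinearType⇒SameCLType φ a∼b)
    SameLinearType⇒SameCLType (φ ⊕ ψ)    a∼b =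
      ℝ.+-cong (SameLinearType⇒SameCLType φ a∼b) (SameLinearType⇒SameCLType ψ a∼b)
    SameLinearType⇒SameCLType (φ ∧ ψ)    a∼b =
      ⊓-cong (SameLinearType⇒SameCLType φ a∼b) (SameLinearType⇒SameCLType ψ a∼b)
    SameLinearType⇒SameCLType (φ ∨ ψ)    a∼b =
      ⊔-cong (SameLinearType⇒SameCLType φ a∼b) (SameLinearType⇒SameCLType ψ a∼b)
    -- Each value over `M` is attained over `N` by `forth`, and conversely by `back`, so the suprema
    -- are taken over the same set of reals.
    SameLinearType⇒SameCLType (Sup φ) {a} {b} a∼b = IsSup-cong ℝ
      (λ c → let e , ca∼eb = forth M N a∼b N-saturated c in e , SameLinearType⇒SameCLType φ ca∼eb)
      (λ e → let c , ca∼eb = back a∼b e in c , SameLinearType⇒SameCLType φ ca∼eb)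
      (proj₂ (ℝ.Range.sup _ M.point (M.bounded-at φ a)))
      (proj₂ (ℝ.Range.sup _ N.point (N.bounded-at φ b)))
    SameLinearType⇒SameCLType (Inf φ) {a} {b} a∼b = IsInf-cong ℝ
      (λ c → let e , ca∼eb = forth M N a∼b N-saturated c in e , SameLinearType⇒SameCLType φ ca∼eb)
      (λ e → let c , ca∼eb = back a∼b e in c , SameLinearType⇒SameCLType φ ca∼eb)
      (proj₂ (ℝ.Range.inf _ M.point (M.bounded-at φ a)))
      (proj₂ (ℝ.Range.inf _ N.point (N.bounded-at φ b)))

proposition4p5 : ∀ {ℓ} (ℝ : CompleteOrderedField ℓ) (τ : Signature ℝ) (M N : Structure τ) →
    M ≡ₗ N → Linearly-ℵ₀-saturated M → Linearly-ℵ₀-saturated N →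
    M ≡CL N
proposition4p5 ℝ τ M N M≡N M-saturated N-saturated σ =
  -- For empty tuples, having the same linear type is exactly `M ≡ₗ N`.
  SameLinearType⇒SameCLType M N M-saturated N-saturated σ M≡N
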